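{- For every $I\in\binom{[n]}{k}$ and $i\in[n]$, $s_it_Is_i=t_{s_iI}$. Moreover: (1) if $i\in I$ and $i+1\notin I$, then $s_it_I<t_I<t_Is_i$; (2) if $i\notin I$ and $i+1\in I$, then $t_Is_i<t_I<s_it_I$; (3) if either both or neither of $i,i+1$ belong to $I$, then $t_I<s_it_I=t_Is_i$ and $s_iI=I$.
   Context: Let $n\ge2$, $0\le k\le n$, $[n]=\{1,\dots,n\}$; membership of $i+1$ in $I$ is read modulo $n$. Affine permutations are bijections $f:\mathbb{Z}\to\mathbb{Z}$ with $f(a+n)=f(a)+n$, multiplied left to right: $(fg)(a)=g(f(a))$. Length: $\ell(f)=\#\{(a,b):a\in[n],b\in\mathbb{Z},a<b,f(a)>f(b)\}$. $s_i$ exchanges $i+mn$ and $i+1+mn$ for all $m\in\mathbb{Z}$ and fixes all other integers; $s_iI$ is the image of $I$ under the induced transposition of $[n]$. For $I\in\binom{[n]}{k}$, $t_I$ is the affine permutation with $t_I(a)=a+n$ if $a\bmod n\in I$ and $t_I(a)=a$ otherwise. "$<$" is the Bruhat order on affine permutations with the same average displacement; for $g=s_if$ or $g=fs_i$, $f<g$ holds iff $\ell(f)<\ell(g)$. -}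

module Defs where

open import Data.Bool.Base using (if_then_else_)
open import Data.Empty using (⊥-elim)
open import Data.Fin.Base using (Fin; zero; suc; toℕ; fromℕ<)
open import Data.Fin.Permutation using (Permutation′; _⟨$⟩ˡ_; transpose)
open import Data.Fin.Properties
  using (_≟_; toℕ-fromℕ<; toℕ-injective; toℕ<n; fromℕ<-toℕ; +↔⊎)
open import Data.Fin.Subset using (Subset; _∈_; _∉_)
open import Data.Fin.Subset.Properties using (_∈?_)
open import Data.Integer.Base as ℤ
  using (ℤ; +_; -_; _+_; _-_; _*_; _<_; _≤_; ∣_∣; 0ℤ; 1ℤ; -1ℤ; _%ℕ_; _/ℕ_; +<+; +≤+)
open import Data.Integer.DivMod using (n%ℕd<d; a≡a%ℕn+[a/ℕn]*n)
import Data.Integer.Properties as ℤ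
open import Data.Integer.Tactic.RingSolver using (solve-∀)
open import Data.Nat.Base as ℕ using (ℕ; NonTrivial; nonTrivial⇒nonZero; nonTrivial⇒n>1; z≤n; s≤s)
import Data.Nat.Properties as ℕ
open import Data.Product.Base using (Σ; Σ-syntax; ∃; ∃-syntax; _×_; _,_; proj₁; proj₂)
open import Data.Sum.Base using (_⊎_; inj₁; inj₂)
open import Data.Sum.Function.Propositional using (_⊎-↔_)
open import Data.Vec.Base using (tabulate; lookup)
open import Function.Bundles using (_↔_; mk↔ₛ′; Inverse)
open import Function.Construct.Composition using (_↔-∘_)
open import Function.Construct.Symmetry using (↔-sym)
open import Relation.Binary.Construct.Closure.Transitive using (TransClosure)
open import Relation.Binary.PropositionalEquality
open import Relation.Nullary using (Dec; yes; no; does; Irrelevant; _×-dec_)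

private variable
  n : ℕ

-- i : Fin n stands for the element i + 1 of [n] = {1,…,n}.
⟦_⟧ : Fin n → ℤ
⟦ i ⟧ = + ℕ.suc (toℕ i)

-- The element of [n] congruent to a modulo n, as characterised by res-decompose
-- and res-unique below.  Opaque because unfolding it makes type checking slow.
opaque
  res : .{{_ : NonTrivial n}} → ℤ → Fin n
  res {n} a = fromℕ< (n%ℕd<d (a - 1ℤ) n {{nonTrivial⇒nonZero n}})

next : .{{_ : NonTrivial n}} → Fin n → Fin n
next i = res (⟦ i ⟧ + 1ℤ)

private
  ∣m-k∣<n : ∀ {m k} → m ℕ.< n → k ℕ.< n → ∣ + m - + k ∣ ℕ.< n
  ∣m-k∣<n {n} {m} {k} m<n k<n with ℕ.≤-total m k
  ... | inj₁ m≤k = ℕ.≤-<-trans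
        (ℕ.≤-reflexive (trans (cong ∣_∣ (ℤ.m-n≡m⊖n m k)) (ℤ.∣⊖∣-≤ m≤k)))
        (ℕ.≤-<-trans (ℕ.m∸n≤m k m) k<n)
  ... | inj₂ k≤m = ℕ.≤-<-trans
        (ℕ.≤-reflexive (trans (cong ∣_∣ (ℤ.m-n≡m⊖n m k))
          (trans (ℤ.∣m⊖n∣≡∣n⊖m∣ m k) (ℤ.∣⊖∣-≤ k≤m))))
        (ℕ.≤-<-trans (ℕ.m∸n≤m m k) m<n)

  small-multiple : ∀ q → ∣ q * + n ∣ ℕ.< n → q ≡ 0ℤ
  small-multiple {n} q lt =
    ℤ.∣i∣≡0⇒i≡0 (zero-factor ∣ q ∣ (subst (ℕ._< n) (ℤ.abs-* q (+ n)) lt))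
    where
    zero-factor : ∀ k → k ℕ.* n ℕ.< n → k ≡ 0
    zero-factor ℕ.zero    _  = refl
    zero-factor (ℕ.suc k) lt = ⊥-elim (ℕ.<⇒≱ lt (ℕ.m≤m+n n (k ℕ.* n)))

⟦⟧-unique : ∀ (r s : Fin n) p q → ⟦ r ⟧ + p * + n ≡ ⟦ s ⟧ + q * + n → r ≡ s
⟦⟧-unique {n} r s p q eq = toℕ-injective (ℤ.+-injective
  (ℤ.i-j≡0⇒i≡j _ _ (trans diff (trans (cong (_* + n) q-p≡0) (ℤ.*-zeroˡ (+ n))))))
  where
  diff : + toℕ r - + toℕ s ≡ (q - p) * + n
  diff = begin
    + toℕ r - + toℕ s
      ≡⟨ lemma (+ toℕ r) (+ toℕ s) p (+ n) ⟩
    (⟦ r ⟧ + p * + n) - (⟦ s ⟧ + p * + n)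
      ≡⟨ cong (_- (⟦ s ⟧ + p * + n)) eq ⟩
    (⟦ s ⟧ + q * + n) - (⟦ s ⟧ + p * + n)
      ≡⟨ lemma′ ⟦ s ⟧ p q (+ n) ⟩
    (q - p) * + n ∎
    where
    open ≡-Reasoning
    lemma : ∀ x y p m → x - y ≡ ((1ℤ + x) + p * m) - ((1ℤ + y) + p * m)
    lemma = solve-∀
    lemma′ : ∀ y p q m → (y + q * m) - (y + p * m) ≡ (q - p) * m
    lemma′ = solve-∀

  q-p≡0 : q - p ≡ 0ℤ
  q-p≡0 = small-multiple (q - p)
    (subst (λ z → ∣ z ∣ ℕ.< n) diff (∣m-k∣<n (toℕ<n r) (toℕ<n s)))

module _ .{{_ : NonTrivial n}} where

  opaque
    unfolding res

    res-decompose : ∀ a → ∃[ q ] a ≡ ⟦ res {n} a ⟧ + q * + n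
    res-decompose a = q , (begin
      a                                     ≡⟨ lemma a ⟩
      1ℤ + (a - 1ℤ)                         ≡⟨ cong (λ x → 1ℤ + x) (a≡a%ℕn+[a/ℕn]*n (a - 1ℤ) n {{nz}}) ⟩
      1ℤ + (+ r + q * + n)                  ≡⟨ ℤ.+-assoc 1ℤ (+ r) (q * + n) ⟨
      + ℕ.suc r + q * + n                   ≡⟨ cong (λ x → + ℕ.suc x + q * + n) (toℕ-fromℕ< r<n) ⟨
      ⟦ res {n} a ⟧ + q * + n               ∎)
      where
      open ≡-Reasoning
      .nz : ℕ.NonZero n
      nz = nonTrivial⇒nonZero n
      r : ℕ
      r = _%ℕ_ (a - 1ℤ) n {{nz}}
      q : ℤ
      q = _/ℕ_ (a - 1ℤ) n {{nz}}
      r<n : r ℕ.< n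
      r<n = n%ℕd<d (a - 1ℤ) n {{nz}}
      lemma : ∀ a → a ≡ 1ℤ + (a - 1ℤ)
      lemma = solve-∀

  res-unique : ∀ {a} (r : Fin n) q → a ≡ ⟦ r ⟧ + q * + n → res a ≡ r
  res-unique {a} r q eq with p , eq′ ← res-decompose a =
    ⟦⟧-unique (res a) r p q (trans (sym eq′) eq)

  res-⟦⟧ : ∀ (i : Fin n) → res ⟦ i ⟧ ≡ i
  res-⟦⟧ i = res-unique i 0ℤ (sym (ℤ.+-identityʳ ⟦ i ⟧))

  res≡⇒ : ∀ {a b} → res {n} a ≡ res b → ∃[ q ] a ≡ b + q * + n
  res≡⇒ {a} {b} eq with p , eqa ← res-decompose a | q , eqb ← res-decompose b =
    p - q , (begin
      a                                          ≡⟨ eqa ⟩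
      ⟦ res {n} a ⟧ + p * + n                    ≡⟨ cong (λ r → ⟦ r ⟧ + p * + n) eq ⟩
      ⟦ res {n} b ⟧ + p * + n                    ≡⟨ lemma ⟦ res {n} b ⟧ p q (+ n) ⟩
      (⟦ res {n} b ⟧ + q * + n) + (p - q) * + n  ≡⟨ cong (_+ (p - q) * + n) eqb ⟨
      b + (p - q) * + n                          ∎)
    where
    open ≡-Reasoning
    lemma : ∀ x p q m → x + p * m ≡ (x + q * m) + (p - q) * m
    lemma = solve-∀

  ⇒res≡ : ∀ {a b} q → a ≡ b + q * + n → res {n} a ≡ res b
  ⇒res≡ {a} {b} q eq with p , eqb ← res-decompose b =
    res-unique (res b) (p + q) (trans eq (trans (cong (_+ q * + n) eqb)
      (lemma ⟦ res {n} b ⟧ p q (+ n))))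
    where
    lemma : ∀ x p q m → (x + p * m) + q * m ≡ x + (p + q) * m
    lemma = solve-∀

  res-+ : ∀ {a b} c → res {n} a ≡ res b → res {n} (a + c) ≡ res (b + c)
  res-+ {a} {b} c eq with q , eq′ ← res≡⇒ {a} {b} eq =
    ⇒res≡ {a + c} {b + c} q (trans (cong (_+ c) eq′) (lemma b c (q * + n)))
    where
    lemma : ∀ b c x → (b + x) + c ≡ (b + c) + x
    lemma = solve-∀

  res-+n : ∀ a → res {n} (a + + n) ≡ res a
  res-+n a = ⇒res≡ {a + + n} {a} 1ℤ (cong (λ z → a + z) (sym (ℤ.*-identityˡ (+ n))))

  res-suc : ∀ a → res {n} a ≢ res (a + 1ℤ)
  res-suc a eq with q , eq′ ← res≡⇒ {a} {a + 1ℤ} eq = absurd q (trans (lemma a (q * + n))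
      (trans (cong (λ z → z - a + -1ℤ) (sym eq′)) (lemma′ a)))
    where
    lemma : ∀ a x → x ≡ ((a + 1ℤ) + x) - a + -1ℤ
    lemma = solve-∀
    lemma′ : ∀ a → a - a + -1ℤ ≡ -1ℤ
    lemma′ = solve-∀
    absurd : ∀ q → q * + n ≢ -1ℤ
    absurd q eq with refl ← small-multiple q
      (subst (λ z → ∣ z ∣ ℕ.< n) (sym eq) (nonTrivial⇒n>1 n))
      with () ← trans (sym eq) (ℤ.*-zeroˡ (+ n))

infix 8 _⟨$⟩_
infixl 7 _·_
infix 4 _≈_

record AffPerm (n : ℕ) : Set where
  field
    perm     : ℤ ↔ ℤ
    periodic : ∀ a → Inverse.to perm (a + + n) ≡ Inverse.to perm a + + n

open AffPerm public

_⟨$⟩_ : AffPerm n → ℤ → ℤ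
f ⟨$⟩ a = Inverse.to (perm f) a

_≈_ : AffPerm n → AffPerm n → Set
f ≈ g = ∀ a → f ⟨$⟩ a ≡ g ⟨$⟩ a

-- Left to right: (f · g) ⟨$⟩ a is g ⟨$⟩ (f ⟨$⟩ a).
_·_ : AffPerm n → AffPerm n → AffPerm n
(f · g) .perm       = perm g ↔-∘ perm f
(f · g) .periodic a = trans (cong (g ⟨$⟩_) (periodic f a)) (periodic g (f ⟨$⟩ a))

-- The two order proofs are propositions, so the elements of this type are
-- exactly the pairs (a , b) counted by the length.
Inversion : AffPerm n → Set
Inversion {n} f =
  Σ[ a ∈ Fin n ] Σ[ b ∈ ℤ ] (⟦ a ⟧ < b × f ⟨$⟩ b < f ⟨$⟩ ⟦ a ⟧)

Finite : Set → Set
Finite A = ∃[ l ] (A ↔ Fin l)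

private
  finite-↔ : ∀ {A B} → A ↔ B → Finite B → Finite A
  finite-↔ e (l , e′) = l , e′ ↔-∘ e

  finite-dec : ∀ {A} → Irrelevant A → Dec A → Finite A
  finite-dec irr (yes a) =
    1 , mk↔ₛ′ (λ _ → zero) (λ _ → a) (λ { zero → refl ; (suc ()) }) (irr a)
  finite-dec irr (no ¬a) =
    0 , mk↔ₛ′ (λ a → ⊥-elim (¬a a)) (λ ()) (λ ()) (λ a → ⊥-elim (¬a a))

  finite-Σ : ∀ m {B : Fin m → Set} → (∀ i → Finite (B i)) → Finite (Σ (Fin m) B)
  finite-Σ ℕ.zero    fin = 0 , mk↔ₛ′ (λ ()) (λ ()) (λ ()) (λ ())
  finite-Σ (ℕ.suc m) fin
    with k , e ← fin zero | l , e′ ← finite-Σ m (λ i → fin (suc i)) =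
    k ℕ.+ l , ↔-sym (+↔⊎ {k} {l}) ↔-∘ ((e ⊎-↔ e′) ↔-∘ mk↔ₛ′
      (λ { (zero , b) → inj₁ b ; (suc i , b) → inj₂ (i , b) })
      (λ { (inj₁ b) → zero , b ; (inj₂ (i , b)) → suc i , b })
      (λ { (inj₁ b) → refl ; (inj₂ (i , b)) → refl })
      (λ { (zero , b) → refl ; (suc i , b) → refl }))

  finite-interval : ∀ {Q : ℤ → Set} c m →
    (∀ {b} → Irrelevant (Q b)) → (∀ b → Dec (Q b)) →
    (∀ {b} → Q b → c ≤ b × b < c + + m) → Finite (Σ ℤ Q)
  finite-interval {Q} c m irr dec bnd = finite-↔
    (mk↔ₛ′ to from to∘from from∘to)
    (finite-Σ m (λ j → finite-dec irr (dec (c + + toℕ j))))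
    where
    R = Σ[ j ∈ Fin m ] Q (c + + toℕ j)

    cancel : ∀ c b → c + (b - c) ≡ b
    cancel = solve-∀

    offset : ∀ {b} → c ≤ b → c + + ∣ b - c ∣ ≡ b
    offset {b} c≤b = trans (cong (λ z → c + z) (ℤ.0≤i⇒+∣i∣≡i (ℤ.i≤j⇒0≤j-i c≤b))) (cancel c b)

    offset<m : ∀ {b} → c ≤ b → b < c + + m → ∣ b - c ∣ ℕ.< m
    offset<m {b} c≤b b<c+m = ℤ.drop‿+<+ (subst₂ _<_
      (sym (ℤ.0≤i⇒+∣i∣≡i (ℤ.i≤j⇒0≤j-i c≤b))) (shift c (+ m))
      (ℤ.+-monoˡ-< (- c) b<c+m))
      where
      shift : ∀ c x → (c + x) - c ≡ x
      shift = solve-∀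

    Σ≡ : ∀ {b b′} {p : Q b} {p′ : Q b′} → b ≡ b′ → _≡_ {A = Σ ℤ Q} (b , p) (b′ , p′)
    Σ≡ {b} {p = p} {p′} refl = cong (λ z → b , z) (irr p p′)

    R≡ : ∀ {j j′} {p : Q (c + + toℕ j)} {p′ : Q (c + + toℕ j′)} →
         j ≡ j′ → _≡_ {A = R} (j , p) (j′ , p′)
    R≡ {j} {p = p} {p′} refl = cong (λ z → j , z) (irr p p′)

    to : Σ ℤ Q → R
    to (b , p) = fromℕ< (offset<m (proj₁ (bnd p)) (proj₂ (bnd p))) ,
      subst Q (sym (trans (cong (λ k → c + + k) (toℕ-fromℕ< _))
        (offset (proj₁ (bnd p))))) p

    from : R → Σ ℤ Q
    from (j , p) = c + + toℕ j , p

    to∘from : ∀ r → to (from r) ≡ r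
    to∘from (j , p) = R≡ (toℕ-injective (trans (toℕ-fromℕ< _)
      (cong ∣_∣ (lemma c (+ toℕ j)))))
      where
      lemma : ∀ c x → (c + x) - c ≡ x
      lemma = solve-∀

    from∘to : ∀ s → from (to s) ≡ s
    from∘to (b , p) = Σ≡ (trans (cong (λ k → c + + k) (toℕ-fromℕ< _))
      (offset (proj₁ (bnd p))))

  upper-bound : ∀ {m} (g : Fin m → ℤ) → ∃[ M ] (∀ i → g i ≤ M)
  upper-bound {ℕ.zero}  g = 0ℤ , λ ()
  upper-bound {ℕ.suc m} g with M , h ← upper-bound (λ i → g (suc i)) =
    g zero ℤ.⊔ M , λ
      { zero    → ℤ.i≤i⊔j (g zero) M
      ; (suc i) → ℤ.≤-trans (h i) (ℤ.i≤j⊔i (g zero) M) }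

  i≤+∣i∣ : ∀ i → i ≤ + ∣ i ∣
  i≤+∣i∣ (+ _)      = ℤ.≤-refl
  i≤+∣i∣ ℤ.-[1+ _ ] = ℤ.-≤+

periodic-* : ∀ (f : AffPerm n) q a → f ⟨$⟩ (a + q * + n) ≡ f ⟨$⟩ a + q * + n
periodic-* {n} f (+ k) a = up k a
  where
  one : ∀ a x → a + 0ℤ * x ≡ a
  one = solve-∀
  step : ∀ a k x → a + (1ℤ + k) * x ≡ (a + k * x) + x
  step = solve-∀
  up : ∀ k a → f ⟨$⟩ (a + + k * + n) ≡ f ⟨$⟩ a + + k * + n
  up ℕ.zero a = trans (cong (f ⟨$⟩_) (one a (+ n))) (sym (one (f ⟨$⟩ a) (+ n)))
  up (ℕ.suc k) a = begin
    f ⟨$⟩ (a + + ℕ.suc k * + n)     ≡⟨ cong (f ⟨$⟩_) (step a (+ k) (+ n)) ⟩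
    f ⟨$⟩ ((a + + k * + n) + + n)   ≡⟨ periodic f _ ⟩
    f ⟨$⟩ (a + + k * + n) + + n     ≡⟨ cong (_+ + n) (up k a) ⟩
    (f ⟨$⟩ a + + k * + n) + + n     ≡⟨ step (f ⟨$⟩ a) (+ k) (+ n) ⟨
    f ⟨$⟩ a + + ℕ.suc k * + n       ∎
    where open ≡-Reasoning
periodic-* {n} f q@(ℤ.-[1+ k ]) a = begin
  f ⟨$⟩ c                          ≡⟨ cancel (f ⟨$⟩ c) q (+ n) ⟩
  (f ⟨$⟩ c + - q * + n) + q * + n  ≡⟨ cong (_+ q * + n) (periodic-* f (- q) c) ⟨
  f ⟨$⟩ (c + - q * + n) + q * + n  ≡⟨ cong (λ z → f ⟨$⟩ z + q * + n) (cancel′ a q (+ n)) ⟩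
  f ⟨$⟩ a + q * + n                ∎
  where
  open ≡-Reasoning
  c = a + q * + n
  cancel : ∀ y q x → y ≡ (y + - q * x) + q * x
  cancel = solve-∀
  cancel′ : ∀ a q x → (a + q * x) + - q * x ≡ a
  cancel′ = solve-∀

module _ .{{_ : NonTrivial n}} where

  opaque
    finite-inversions : ∀ (f : AffPerm n) → Finite (Inversion f)
    finite-inversions f = finite-Σ n λ a → finite-interval ⟦ a ⟧ (m a)
      (λ { (p , q) (p′ , q′) → cong₂ _,_ (ℤ.<-irrelevant p p′) (ℤ.<-irrelevant q q′) })
      (λ b → (⟦ a ⟧ ℤ.<? b) ×-dec (f ⟨$⟩ b ℤ.<? f ⟨$⟩ ⟦ a ⟧))
      (λ { {b} (p , q) → ℤ.<⇒≤ p , window a b q })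
      where
      bound : ∃[ M ] (∀ (r : Fin n) → ⟦ r ⟧ - f ⟨$⟩ ⟦ r ⟧ ≤ M)
      bound = upper-bound (λ r → ⟦ r ⟧ - f ⟨$⟩ ⟦ r ⟧)
      M : ℤ
      M = proj₁ bound

      m : Fin n → ℕ
      m a = ∣ (M + f ⟨$⟩ ⟦ a ⟧) - ⟦ a ⟧ ∣

      drop : ∀ b → b - f ⟨$⟩ b ≤ M
      drop b with q , eq ← res-decompose {n} b = subst (_≤ M) (begin
        ⟦ r ⟧ - f ⟨$⟩ ⟦ r ⟧                            ≡⟨ lemma ⟦ r ⟧ (f ⟨$⟩ ⟦ r ⟧) (q * + n) ⟩
        (⟦ r ⟧ + q * + n) - (f ⟨$⟩ ⟦ r ⟧ + q * + n)    ≡⟨ cong (λ z → (⟦ r ⟧ + q * + n) - z) (periodic-* f q ⟦ r ⟧) ⟨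
        (⟦ r ⟧ + q * + n) - f ⟨$⟩ (⟦ r ⟧ + q * + n)    ≡⟨ cong (λ z → z - f ⟨$⟩ z) eq ⟨
        b - f ⟨$⟩ b                                    ∎) (proj₂ bound r)
        where
        open ≡-Reasoning
        r : Fin n
        r = res b
        lemma : ∀ x y z → x - y ≡ (x + z) - (y + z)
        lemma = solve-∀

      window : ∀ a b → f ⟨$⟩ b < f ⟨$⟩ ⟦ a ⟧ → b < ⟦ a ⟧ + + m a
      window a b q = begin-strict
        b                                        ≡⟨ lemma b (f ⟨$⟩ b) ⟩
        (b - f ⟨$⟩ b) + f ⟨$⟩ b                  <⟨ ℤ.+-mono-≤-< (drop b) q ⟩
        M + f ⟨$⟩ ⟦ a ⟧                          ≡⟨ lemma′ (M + f ⟨$⟩ ⟦ a ⟧) ⟦ a ⟧ ⟩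
        ⟦ a ⟧ + ((M + f ⟨$⟩ ⟦ a ⟧) - ⟦ a ⟧)      ≤⟨ ℤ.+-monoʳ-≤ ⟦ a ⟧ (i≤+∣i∣ ((M + f ⟨$⟩ ⟦ a ⟧) - ⟦ a ⟧)) ⟩
        ⟦ a ⟧ + + m a                            ∎
        where
        open ℤ.≤-Reasoning
        lemma : ∀ x y → x ≡ (x - y) + y
        lemma = solve-∀
        lemma′ : ∀ x y → x ≡ y + (x - y)
        lemma′ = solve-∀

  ℓ : AffPerm n → ℕ
  ℓ f = proj₁ (finite-inversions f)

  inversions↔Fin : ∀ f → Inversion f ↔ Fin (ℓ f)
  inversions↔Fin f = proj₂ (finite-inversions f)

  -- For a ≢ b modulo n: exchange a + mn and b + mn for every integer m.
  exchange : ℤ → ℤ → ℤ → ℤ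
  exchange a b c =
    if does (res {n} c ≟ res a) then c + (b - a) else
    if does (res {n} c ≟ res b) then c + (a - b) else c

  exchange-left : ∀ a b {c} → res {n} c ≡ res a → exchange a b c ≡ c + (b - a)
  exchange-left a b {c} eq with res {n} c ≟ res a
  ... | yes _  = refl
  ... | no ¬eq = ⊥-elim (¬eq eq)

  exchange-right : ∀ a b {c} → res {n} a ≢ res b → res {n} c ≡ res b →
                   exchange a b c ≡ c + (a - b)
  exchange-right a b {c} a≢b eq with res {n} c ≟ res a
  ... | yes eq′ = ⊥-elim (a≢b (trans (sym eq′) eq))
  ... | no _ with res {n} c ≟ res b
  ...   | yes _  = refl
  ...   | no ¬eq = ⊥-elim (¬eq eq)

  exchange-other : ∀ a b {c} → res {n} c ≢ res a → res {n} c ≢ res b →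
                   exchange a b c ≡ c
  exchange-other a b {c} ¬a ¬b with res {n} c ≟ res a
  ... | yes eq = ⊥-elim (¬a eq)
  ... | no _ with res {n} c ≟ res b
  ...   | yes eq = ⊥-elim (¬b eq)
  ...   | no _   = refl

  private
    move : ∀ a b {c} → res {n} c ≡ res a → res {n} (c + (b - a)) ≡ res b
    move a b {c} eq = trans (res-+ {a = c} {b = a} (b - a) eq) (cong (res {n}) (lemma a b))
      where
      lemma : ∀ a b → a + (b - a) ≡ b
      lemma = solve-∀

    back : ∀ a b c → (c + (b - a)) + (a - b) ≡ c
    back = solve-∀

    +-swap : ∀ c x m → (c + m) + x ≡ (c + x) + m
    +-swap = solve-∀

  exchange-involutive : ∀ a b → res {n} a ≢ res b → ∀ c → exchange a b (exchange a b c) ≡ c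
  exchange-involutive a b a≢b c with res {n} c ≟ res a
  ... | yes c≡a = trans (exchange-right a b {c + (b - a)} a≢b (move a b {c} c≡a)) (back a b c)
  ... | no c≢a with res {n} c ≟ res b
  ...   | yes c≡b = trans (exchange-left a b {c + (a - b)} (move b a {c} c≡b)) (back b a c)
  ...   | no c≢b  = exchange-other a b {c} c≢a c≢b

  exchange-periodic : ∀ a b → res {n} a ≢ res b → ∀ c →
                      exchange a b (c + + n) ≡ exchange a b c + + n
  exchange-periodic a b a≢b c with res {n} c ≟ res a
  ... | yes c≡a = trans (exchange-left a b {c + + n} (trans (res-+n c) c≡a))
                        (+-swap c (b - a) (+ n))
  ... | no c≢a with res {n} c ≟ res b
  ...   | yes c≡b = trans (exchange-right a b {c + + n} a≢b (trans (res-+n c) c≡b))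
                          (+-swap c (a - b) (+ n))
  ...   | no c≢b  = exchange-other a b {c + + n}
                      (λ eq → c≢a (trans (sym (res-+n c)) eq))
                      (λ eq → c≢b (trans (sym (res-+n c)) eq))

  reflection : ∀ a b → res {n} a ≢ res b → AffPerm n
  reflection a b a≢b .perm     = mk↔ₛ′ (exchange a b) (exchange a b)
    (exchange-involutive a b a≢b) (exchange-involutive a b a≢b)
  reflection a b a≢b .periodic = exchange-periodic a b a≢b

  infix 4 _⟶ᴮ_ _<ᴮ_

  _⟶ᴮ_ : AffPerm n → AffPerm n → Set
  f ⟶ᴮ g = ∃[ a ] ∃[ b ] Σ[ a≢b ∈ res {n} a ≢ res b ]
    (g ≈ reflection a b a≢b · f × ℓ f ℕ.< ℓ g)

  -- The strict Bruhat order.  Multiplying by a reflection does not change the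
  -- average displacement, so comparable elements always have the same one; and
  -- since reflections are closed under conjugation by affine permutations,
  -- multiplying on the right instead of the left gives the same relation.
  _<ᴮ_ : AffPerm n → AffPerm n → Set
  _<ᴮ_ = TransClosure _⟶ᴮ_

  s : Fin n → AffPerm n
  s i = reflection ⟦ i ⟧ (⟦ i ⟧ + 1ℤ) (res-suc ⟦ i ⟧)

  -- translate I x moves the integers whose residue lies in I by x.
  translate : Subset n → ℤ → ℤ → ℤ
  translate I x a = if does (res a ∈? I) then a + x else a

  translate-∈ : ∀ I x {a} → res a ∈ I → translate I x a ≡ a + x
  translate-∈ I x {a} a∈I with res a ∈? I
  ... | yes _  = refl
  ... | no a∉I = ⊥-elim (a∉I a∈I)

  translate-∉ : ∀ I x {a} → res a ∉ I → translate I x a ≡ a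
  translate-∉ I x {a} a∉I with res a ∈? I
  ... | yes a∈I = ⊥-elim (a∉I a∈I)
  ... | no _    = refl

  private
    res-n : ∀ a → res {n} (a - + n) ≡ res a
    res-n a = trans (sym (res-+n (a - + n))) (cong (res {n}) (lemma a (+ n)))
      where
      lemma : ∀ a x → (a - x) + x ≡ a
      lemma = solve-∀

    translate-inverse : ∀ I x y → (∀ a → (a + x) + y ≡ a) →
      (∀ a → res {n} (a + x) ≡ res a) → ∀ a → translate I y (translate I x a) ≡ a
    translate-inverse I x y x+y res-x a with res {n} a ∈? I
    ... | yes a∈I = trans (translate-∈ I y {a + x} (subst (_∈ I) (sym (res-x a)) a∈I)) (x+y a)
    ... | no a∉I  = translate-∉ I y {a} a∉I

  t : Subset n → AffPerm n
  t I .perm = mk↔ₛ′ (translate I (+ n)) (translate I (- + n))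
    (translate-inverse I (- + n) (+ n) (λ a → minus-plus a (+ n)) res-n)
    (translate-inverse I (+ n) (- + n) (λ a → plus-minus a (+ n)) res-+n)
    where
    minus-plus : ∀ a x → (a - x) + x ≡ a
    minus-plus = solve-∀
    plus-minus : ∀ a x → (a + x) - x ≡ a
    plus-minus = solve-∀
  t I .periodic a with res {n} a ∈? I
  ... | yes a∈I = translate-∈ I (+ n) {a + + n} (subst (_∈ I) (sym (res-+n a)) a∈I)
  ... | no a∉I  = translate-∉ I (+ n) {a + + n} (λ p → a∉I (subst (_∈ I) (res-+n a) p))

  image : Permutation′ n → Subset n → Subset n
  image π I = tabulate λ j → lookup I (π ⟨$⟩ˡ j)

  infixr 9 _∙_

  -- s_i I, for the transposition of [n] exchanging i and i + 1 modulo n.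
  _∙_ : Fin n → Subset n → Subset n
  i ∙ I = image (transpose i (next i)) I

{-# OPTIONS --safe #-}
module Submission where

-- If every inversion (a , b) of f is carried to an inversion (φ a , φ b) of g
-- by an affine permutation φ, and some inversion of g is not obtained this way,
-- then ℓ f < ℓ g.  With φ = s i this settles left multiplication by s i, because
-- s i reverses only the pairs (a , a + 1) with a ≡ i modulo n; with φ the
-- identity it settles right multiplication.  What remains is to compare the
-- values of t I at i and i + 1, and their preimages.

open import Defs
open import Data.Empty using (⊥-elim)
open import Data.Fin.Base using (Fin; zero; suc)
open import Data.Fin.Permutation.Components using (transpose)
open import Data.Fin.Properties using (_≟_; injective⇒≤)
open import Data.Fin.Subset using (Subset; _∈_; _∉_; ∣_∣; inside; outside)
open import Data.Fin.Subset.Properties using (_∈?_)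
open import Data.Integer.Base as ℤ using (ℤ; +_; -_; _+_; _-_; _*_; _<_; 0ℤ; 1ℤ; -1ℤ; +<+)
import Data.Integer.Properties as ℤ
open import Algebra.Properties.AbelianGroup ℤ.+-0-abelianGroup using (∙-cancelˡ)
open import Data.Integer.Tactic.RingSolver using (solve-∀)
open import Data.Nat.Base as ℕ using (ℕ; NonTrivial; _≤_; nonTrivial⇒n>1)
open import Data.Product.Base using (∃-syntax; _×_; _,_; proj₁; proj₂)
open import Data.Sum.Base using (_⊎_; inj₁; inj₂)
open import Data.Vec.Base using (lookup)
open import Data.Vec.Properties
  using (lookup∘tabulate; tabulate∘lookup; tabulate-cong; []=⇒lookup; lookup⇒[]=)
open import Function.Base using (_∘_)
open import Function.Bundles using (_↔_; Inverse)
open import Function.Construct.Identity using (↔-id)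
open import Function.Definitions using (Injective)
open import Relation.Binary.Construct.Closure.Transitive using ([_])
open import Relation.Binary.PropositionalEquality
open import Relation.Nullary using (¬_; Dec; yes; no)

private variable
  m n : ℕ

injective∧missing⇒< : {h : Fin m → Fin n} → Injective _≡_ _≡_ h →
                      ∀ k → (∀ j → h j ≢ k) → m ℕ.< n
injective∧missing⇒< {m} {n} {h} h-inj k missing = injective⇒≤ {f = h′} h′-inj
  where
  h′ : Fin (ℕ.suc m) → Fin n
  h′ zero    = k
  h′ (suc j) = h j

  h′-inj : Injective _≡_ _≡_ h′
  h′-inj {zero}  {zero}  _  = refl
  h′-inj {zero}  {suc j} eq = ⊥-elim (missing j (sym eq))
  h′-inj {suc j} {zero}  eq = ⊥-elim (missing j eq)
  h′-inj {suc j} {suc l} eq = cong suc (h-inj eq)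

≡transpose : {i j k l : Fin n} → (k ≡ i → l ≡ j) → (k ≡ j → l ≡ i) →
             (k ≢ i → k ≢ j → l ≡ k) → l ≡ transpose i j k
≡transpose {i = i} {j} {k} at-i at-j elsewhere with k ≟ i
... | yes k≡i = at-i k≡i
... | no k≢i with k ≟ j
...   | yes k≡j = at-j k≡j
...   | no k≢j  = elsewhere k≢i k≢j

to-injective : {A B : Set} (e : A ↔ B) → Injective _≡_ _≡_ (Inverse.to e)
to-injective e {x} {y} eq = trans (sym (Inverse.strictlyInverseʳ e x))
  (trans (cong (Inverse.from e) eq) (Inverse.strictlyInverseʳ e y))

idᴬ : AffPerm n
idᴬ .perm       = ↔-id ℤ
idᴬ .periodic _ = refl

a<a+1 : ∀ a → a < a + 1ℤ
a<a+1 a = subst (_< a + 1ℤ) (ℤ.+-identityʳ a) (ℤ.+-monoʳ-< a (+<+ (ℕ.s≤s ℕ.z≤n)))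

a<b⇒a≤b-1 : ∀ {a b} → a < b → a ℤ.≤ b - 1ℤ
a<b⇒a≤b-1 {a} {b} a<b = subst (a ℤ.≤_) (ℤ.+-comm -1ℤ b) (ℤ.i<j⇒i≤pred[j] a<b)

shift-cancel : ∀ x q m → (x + q * m) + - q * m ≡ x
shift-cancel = solve-∀

module _ .{{_ : NonTrivial n}} where

  +1<+n : ∀ a → a + 1ℤ < a + + n
  +1<+n a = ℤ.+-monoʳ-< a (+<+ (nonTrivial⇒n>1 n))

  -- Opaque because comparing the order proofs inside Inversion f is slow.
  opaque
    inversionAt : ∀ (f : AffPerm n) a b → a < b → f ⟨$⟩ b < f ⟨$⟩ a → Inversion f
    inversionAt f a b a<b fb<fa =
      res a , b + - q * + n ,
      subst (_< b + - q * + n) shift (ℤ.+-monoˡ-< (- q * + n) a<b) ,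
      subst₂ _<_ (sym (periodic-* f (- q) b))
        (trans (sym (periodic-* f (- q) a)) (cong (f ⟨$⟩_) shift))
        (ℤ.+-monoˡ-< (- q * + n) fb<fa)
      where
      q : ℤ
      q = proj₁ (res-decompose {n} a)
      shift : a + - q * + n ≡ ⟦ res {n} a ⟧
      shift = trans (cong (_+ - q * + n) (proj₂ (res-decompose {n} a)))
        (shift-cancel ⟦ res {n} a ⟧ q (+ n))

    inversionAt-shift : ∀ (f : AffPerm n) a b a<b fb<fa →
      let v = inversionAt f a b a<b fb<fa in
      ∃[ q ] a ≡ ⟦ proj₁ v ⟧ + q * + n × b ≡ proj₁ (proj₂ v) + q * + n
    inversionAt-shift f a b _ _ =
      proj₁ (res-decompose {n} a) , proj₂ (res-decompose {n} a) ,
      lemma b (proj₁ (res-decompose {n} a)) (+ n)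
      where
      lemma : ∀ x q m → x ≡ (x + - q * m) + q * m
      lemma = solve-∀

  inversionAt-injective : ∀ (f : AffPerm n) {a b a′ b′ p q p′ q′} →
    inversionAt f a b p q ≡ inversionAt f a′ b′ p′ q′ →
    ∃[ r ] a ≡ a′ + r * + n × b ≡ b′ + r * + n
  inversionAt-injective f {a} {b} {a′} {b′} {p} {q} {p′} {q′} eq =
    same-shift eq (inversionAt-shift f a b p q) (inversionAt-shift f a′ b′ p′ q′)
    where
    lemma : ∀ x k l m → x + k * m ≡ (x + l * m) + (k - l) * m
    lemma = solve-∀

    same-shift : ∀ {v w : Inversion f} → v ≡ w →
      ∃[ k ] a ≡ ⟦ proj₁ v ⟧ + k * + n × b ≡ proj₁ (proj₂ v) + k * + n →
      ∃[ l ] a′ ≡ ⟦ proj₁ w ⟧ + l * + n × b′ ≡ proj₁ (proj₂ w) + l * + n →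
      ∃[ r ] a ≡ a′ + r * + n × b ≡ b′ + r * + n
    same-shift {c , d , _} refl (k , refl , refl) (l , refl , refl) =
      k - l , lemma ⟦ c ⟧ k l (+ n) , lemma d k l (+ n)

  Inversion-≡ : ∀ {f : AffPerm n} {v w : Inversion f} r →
    ⟦ proj₁ v ⟧ ≡ ⟦ proj₁ w ⟧ + r * + n → proj₁ (proj₂ v) ≡ proj₁ (proj₂ w) + r * + n → v ≡ w
  Inversion-≡ {v = a , b , p} {a′ , b′ , p′} r eqa eqb
    with refl ← ⟦⟧-unique a a′ 0ℤ r (trans (ℤ.+-identityʳ ⟦ a ⟧) eqa)
    with refl ← trans eqb (trans (cong (λ z → b′ + z) (∙-cancelˡ ⟦ a ⟧ (r * + n) 0ℤ
                  (trans (sym eqa) (sym (ℤ.+-identityʳ ⟦ a ⟧))))) (ℤ.+-identityʳ b′)) =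
    cong (λ z → a , b , z) (cong₂ _,_ (ℤ.<-irrelevant (proj₁ p) (proj₁ p′))
                                      (ℤ.<-irrelevant (proj₂ p) (proj₂ p′)))

  ℓ-< : ∀ (f g φ : AffPerm n) →
    (∀ a b → a < b → f ⟨$⟩ b < f ⟨$⟩ a →
      φ ⟨$⟩ a < φ ⟨$⟩ b × g ⟨$⟩ (φ ⟨$⟩ b) < g ⟨$⟩ (φ ⟨$⟩ a)) →
    ∀ x y → φ ⟨$⟩ x < φ ⟨$⟩ y → g ⟨$⟩ (φ ⟨$⟩ y) < g ⟨$⟩ (φ ⟨$⟩ x) →
    ¬ (x < y × f ⟨$⟩ y < f ⟨$⟩ x) → ℓ f ℕ.< ℓ g
  ℓ-< f g φ push x y φx<φy gφy<gφx new = injective∧missing⇒<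
    {h = λ j → G.to (pushed (F.from j))}
    (λ eq → from-injective (pushed-injective (to-injective (inversions↔Fin g) eq)))
    (G.to extra)
    (λ j eq → missing (F.from j) (to-injective (inversions↔Fin g) eq))
    where
    module F = Inverse (inversions↔Fin f)
    module G = Inverse (inversions↔Fin g)

    pushed : Inversion f → Inversion g
    pushed (a , b , a<b , fb<fa) = inversionAt g (φ ⟨$⟩ ⟦ a ⟧) (φ ⟨$⟩ b)
      (proj₁ (push ⟦ a ⟧ b a<b fb<fa)) (proj₂ (push ⟦ a ⟧ b a<b fb<fa))

    extra : Inversion g
    extra = inversionAt g (φ ⟨$⟩ x) (φ ⟨$⟩ y) φx<φy gφy<gφx

    from-injective : Injective _≡_ _≡_ F.from
    from-injective {i} {j} eq = trans (sym (F.strictlyInverseˡ i))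
      (trans (cong F.to eq) (F.strictlyInverseˡ j))

    pull : ∀ {a b} r → φ ⟨$⟩ a ≡ φ ⟨$⟩ b + r * + n → a ≡ b + r * + n
    pull {a} {b} r eq = to-injective (perm φ) (trans eq (sym (periodic-* φ r b)))

    pushed-injective : Injective _≡_ _≡_ pushed
    pushed-injective {v} {w} eq with r , eqa , eqb ← inversionAt-injective g eq =
      Inversion-≡ {f = f} {v} {w} r (pull r eqa) (pull r eqb)

    missing : ∀ v → pushed v ≢ extra
    missing (a , b , a<b , fb<fa) eq with r , eqa , eqb ← inversionAt-injective g eq =
      new (unshift (subst₂ _<_ (pull r eqa) (pull r eqb) a<b) ,
           unshift (subst₂ _<_ (trans (cong (f ⟨$⟩_) (pull r eqb)) (periodic-* f r y))
                               (trans (cong (f ⟨$⟩_) (pull r eqa)) (periodic-* f r x)) fb<fa))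
      where
      unshift : ∀ {c d} → c + r * + n < d + r * + n → c < d
      unshift {c} {d} lt = subst₂ _<_ (shift-cancel c r (+ n)) (shift-cancel d r (+ n))
        (ℤ.+-monoˡ-< (- r * + n) lt)

  s-here : ∀ i {c} → res c ≡ i → s i ⟨$⟩ c ≡ c + 1ℤ
  s-here i {c} eq = trans
    (exchange-left ⟦ i ⟧ (⟦ i ⟧ + 1ℤ) {c} (trans eq (sym (res-⟦⟧ i)))) (lemma c ⟦ i ⟧)
    where
    lemma : ∀ c x → c + ((x + 1ℤ) - x) ≡ c + 1ℤ
    lemma = solve-∀

  s-next : ∀ i {c} → res c ≡ next i → s i ⟨$⟩ c ≡ c - 1ℤ
  s-next i {c} eq = trans
    (exchange-right ⟦ i ⟧ (⟦ i ⟧ + 1ℤ) {c} (res-suc ⟦ i ⟧) eq) (lemma c ⟦ i ⟧)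
    where
    lemma : ∀ c x → c + (x - (x + 1ℤ)) ≡ c - 1ℤ
    lemma = solve-∀

  s-other : ∀ i {c} → res c ≢ i → res c ≢ next i → s i ⟨$⟩ c ≡ c
  s-other i {c} ≢i ≢next = exchange-other ⟦ i ⟧ (⟦ i ⟧ + 1ℤ) {c}
    (λ eq → ≢i (trans eq (res-⟦⟧ i))) ≢next

  s-involutive : ∀ i c → s i ⟨$⟩ (s i ⟨$⟩ c) ≡ c
  s-involutive i = exchange-involutive ⟦ i ⟧ (⟦ i ⟧ + 1ℤ) (res-suc ⟦ i ⟧)

  s-⟦i⟧ : ∀ i → s i ⟨$⟩ ⟦ i ⟧ ≡ ⟦ i ⟧ + 1ℤ
  s-⟦i⟧ i = s-here i {⟦ i ⟧} (res-⟦⟧ i)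

  s-⟦i⟧+1 : ∀ i → s i ⟨$⟩ (⟦ i ⟧ + 1ℤ) ≡ ⟦ i ⟧
  s-⟦i⟧+1 i = trans (cong (s i ⟨$⟩_) (sym (s-⟦i⟧ i))) (s-involutive i ⟦ i ⟧)

  s-lower : ∀ i c → c - 1ℤ ℤ.≤ s i ⟨$⟩ c
  s-lower i c = by-cases (res c ≟ i) (res c ≟ next i)
    where
    by-cases : Dec (res c ≡ i) → Dec (res c ≡ next i) → c - 1ℤ ℤ.≤ s i ⟨$⟩ c
    by-cases (yes eq) _        = subst (c - 1ℤ ℤ.≤_) (sym (s-here i {c} eq)) (ℤ.+-monoʳ-≤ c ℤ.-≤+)
    by-cases (no _)   (yes eq) = ℤ.≤-reflexive (sym (s-next i {c} eq))
    by-cases (no ≢i)  (no ≢n)  = subst (c - 1ℤ ℤ.≤_) (sym (s-other i {c} ≢i ≢n)) (ℤ.i-j≤i c 1ℤ)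

  s-upper : ∀ i c → res c ≢ i → s i ⟨$⟩ c ℤ.≤ c
  s-upper i c ≢i = by-cases (res c ≟ next i)
    where
    by-cases : Dec (res c ≡ next i) → s i ⟨$⟩ c ℤ.≤ c
    by-cases (yes eq) = subst (ℤ._≤ c) (sym (s-next i {c} eq)) (ℤ.i-j≤i c 1ℤ)
    by-cases (no ≢n)  = ℤ.≤-reflexive (s-other i {c} ≢i ≢n)

  s-mono : ∀ i {a b} → a < b → ¬ (res a ≡ i × b ≡ a + 1ℤ) → s i ⟨$⟩ a < s i ⟨$⟩ b
  s-mono i {a} {b} a<b not-swapped = ℤ.≤∧≢⇒< s-a≤s-b
    (λ eq → ℤ.<⇒≢ a<b (to-injective (perm (s i)) eq))
    where
    a+1≤b : a + 1ℤ ℤ.≤ b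
    a+1≤b = subst (ℤ._≤ b) (ℤ.+-comm 1ℤ a) (ℤ.i<j⇒suc[i]≤j a<b)

    by-cases : Dec (res a ≡ i) → s i ⟨$⟩ a ℤ.≤ s i ⟨$⟩ b
    by-cases (no ≢i)  = ℤ.≤-trans (s-upper i a ≢i) (ℤ.≤-trans (a<b⇒a≤b-1 a<b) (s-lower i b))
    by-cases (yes eq) = subst (ℤ._≤ s i ⟨$⟩ b) (sym (s-here i {a} eq))
      (ℤ.≤-trans (a<b⇒a≤b-1 (ℤ.≤∧≢⇒< a+1≤b (λ e → not-swapped (eq , sym e)))) (s-lower i b))

    s-a≤s-b : s i ⟨$⟩ a ℤ.≤ s i ⟨$⟩ b
    s-a≤s-b = by-cases (res a ≟ i)

  s·f-ascent : ∀ i (f g : AffPerm n) → g ≈ s i · f → f ⟨$⟩ ⟦ i ⟧ < f ⟨$⟩ (⟦ i ⟧ + 1ℤ) → f <ᴮ g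
  s·f-ascent i f g g≈ asc =
    [ ⟦ i ⟧ , ⟦ i ⟧ + 1ℤ , res-suc ⟦ i ⟧ , g≈ , ℓ-< f g (s i) push (⟦ i ⟧ + 1ℤ) ⟦ i ⟧
      (subst₂ _<_ (sym (s-⟦i⟧+1 i)) (sym (s-⟦i⟧ i)) (a<a+1 ⟦ i ⟧))
      (subst₂ _<_ (sym (g∘s ⟦ i ⟧)) (sym (g∘s (⟦ i ⟧ + 1ℤ))) asc)
      (λ (lt , _) → ℤ.<-asym lt (a<a+1 ⟦ i ⟧)) ]
    where
    g∘s : ∀ c → g ⟨$⟩ (s i ⟨$⟩ c) ≡ f ⟨$⟩ c
    g∘s c = trans (g≈ (s i ⟨$⟩ c)) (cong (f ⟨$⟩_) (s-involutive i c))

    ascent : ∀ {a} → res {n} a ≡ i → f ⟨$⟩ a < f ⟨$⟩ (a + 1ℤ)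
    ascent {a} refl with q , eq ← res-decompose {n} a = subst₂ _<_
      (trans (sym (periodic-* f q ⟦ i ⟧)) (cong (f ⟨$⟩_) (sym eq)))
      (trans (sym (periodic-* f q (⟦ i ⟧ + 1ℤ)))
        (cong (f ⟨$⟩_) (trans (lemma ⟦ i ⟧ (q * + n)) (cong (_+ 1ℤ) (sym eq)))))
      (ℤ.+-monoˡ-< (q * + n) asc)
      where
      lemma : ∀ x y → (x + 1ℤ) + y ≡ (x + y) + 1ℤ
      lemma = solve-∀

    push : ∀ a b → a < b → f ⟨$⟩ b < f ⟨$⟩ a →
           s i ⟨$⟩ a < s i ⟨$⟩ b × g ⟨$⟩ (s i ⟨$⟩ b) < g ⟨$⟩ (s i ⟨$⟩ a)
    push a b a<b fb<fa =
      s-mono i a<b (λ { (eq , refl) → ℤ.<-asym fb<fa (ascent {a} eq) }) ,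
      subst₂ _<_ (sym (g∘s b)) (sym (g∘s a)) fb<fa

  res-⟨$⟩ : ∀ (f : AffPerm n) {a b} → res {n} a ≡ res b → res {n} (f ⟨$⟩ a) ≡ res (f ⟨$⟩ b)
  res-⟨$⟩ f {a} {b} eq with q , eq′ ← res≡⇒ {a = a} {b} eq =
    ⇒res≡ {a = f ⟨$⟩ a} {f ⟨$⟩ b} q (trans (cong (f ⟨$⟩_) eq′) (periodic-* f q b))

  res-⟨$⟩⁻¹ : ∀ (f : AffPerm n) {a b} → res {n} (f ⟨$⟩ a) ≡ res (f ⟨$⟩ b) → res {n} a ≡ res b
  res-⟨$⟩⁻¹ f {a} {b} eq with q , eq′ ← res≡⇒ {a = f ⟨$⟩ a} {f ⟨$⟩ b} eq =
    ⇒res≡ {a = a} {b} q (to-injective (perm f) (trans eq′ (sym (periodic-* f q b))))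

  exchange-⟨$⟩ : ∀ (f : AffPerm n) a b → res {n} a ≢ res b → ∀ c →
    exchange {n} (f ⟨$⟩ a) (f ⟨$⟩ b) (f ⟨$⟩ c) ≡ f ⟨$⟩ exchange {n} a b c
  exchange-⟨$⟩ f a b a≢b c = by-cases
    where
    lemma : ∀ x y z → (x + z) + (y - x) ≡ y + z
    lemma = solve-∀

    moved : ∀ x y → res {n} c ≡ res x → f ⟨$⟩ c + (f ⟨$⟩ y - f ⟨$⟩ x) ≡ f ⟨$⟩ (c + (y - x))
    moved x y eq with q , eq′ ← res≡⇒ {a = c} {x} eq = begin
      f ⟨$⟩ c + (f ⟨$⟩ y - f ⟨$⟩ x)
        ≡⟨ cong (_+ (f ⟨$⟩ y - f ⟨$⟩ x)) (trans (cong (f ⟨$⟩_) eq′) (periodic-* f q x)) ⟩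
      (f ⟨$⟩ x + q * + n) + (f ⟨$⟩ y - f ⟨$⟩ x)
        ≡⟨ lemma (f ⟨$⟩ x) (f ⟨$⟩ y) (q * + n) ⟩
      f ⟨$⟩ y + q * + n
        ≡⟨ periodic-* f q y ⟨
      f ⟨$⟩ (y + q * + n)
        ≡⟨ cong (f ⟨$⟩_) (trans (cong (_+ (y - x)) eq′) (lemma x y (q * + n))) ⟨
      f ⟨$⟩ (c + (y - x)) ∎
      where open ≡-Reasoning

    by-cases : exchange {n} (f ⟨$⟩ a) (f ⟨$⟩ b) (f ⟨$⟩ c) ≡ f ⟨$⟩ exchange {n} a b c
    by-cases with res {n} c ≟ res a
    ... | yes c≡a = trans (exchange-left (f ⟨$⟩ a) (f ⟨$⟩ b) {f ⟨$⟩ c} (res-⟨$⟩ f {c} {a} c≡a))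
                          (moved a b c≡a)
    ... | no c≢a with res {n} c ≟ res b
    ...   | yes c≡b = trans
              (exchange-right (f ⟨$⟩ a) (f ⟨$⟩ b) {f ⟨$⟩ c} (a≢b ∘ res-⟨$⟩⁻¹ f {a} {b})
                (res-⟨$⟩ f {c} {b} c≡b))
              (moved b a c≡b)
    ...   | no c≢b  = exchange-other (f ⟨$⟩ a) (f ⟨$⟩ b) {f ⟨$⟩ c}
              (c≢a ∘ res-⟨$⟩⁻¹ f {c} {a}) (c≢b ∘ res-⟨$⟩⁻¹ f {c} {b})

  f·s-ascent : ∀ i (f g : AffPerm n) {x y} → g ≈ f · s i →
           f ⟨$⟩ x ≡ ⟦ i ⟧ → f ⟨$⟩ y ≡ ⟦ i ⟧ + 1ℤ → x < y → f <ᴮ g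
  f·s-ascent i f g {x} {y} g≈ fx fy x<y =
    [ x , y , x≢y , (λ c → trans (g≈ c) (conjugate c)) , ℓ-< f g idᴬ push x y x<y
      (subst₂ _<_ (sym gy) (sym gx) (a<a+1 ⟦ i ⟧))
      (λ (_ , lt) → ℤ.<-asym lt (subst₂ _<_ (sym fx) (sym fy) (a<a+1 ⟦ i ⟧))) ]
    where
    x≢y : res {n} x ≢ res y
    x≢y eq = res-suc ⟦ i ⟧ (subst₂ (λ u v → res {n} u ≡ res v) fx fy (res-⟨$⟩ f {x} {y} eq))

    conjugate : ∀ c → s i ⟨$⟩ (f ⟨$⟩ c) ≡ f ⟨$⟩ exchange {n} x y c
    conjugate c = trans (cong₂ (λ u v → exchange {n} u v (f ⟨$⟩ c)) (sym fx) (sym fy))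
      (exchange-⟨$⟩ f x y x≢y c)

    gx : g ⟨$⟩ x ≡ ⟦ i ⟧ + 1ℤ
    gx = trans (g≈ x) (trans (cong (s i ⟨$⟩_) fx) (s-⟦i⟧ i))

    gy : g ⟨$⟩ y ≡ ⟦ i ⟧
    gy = trans (g≈ y) (trans (cong (s i ⟨$⟩_) fy) (s-⟦i⟧+1 i))

    push : ∀ a b → a < b → f ⟨$⟩ b < f ⟨$⟩ a → a < b × g ⟨$⟩ b < g ⟨$⟩ a
    push a b a<b fb<fa = a<b , subst₂ _<_ (sym (g≈ b)) (sym (g≈ a)) (s-mono i fb<fa swapped)
      where
      swapped : ¬ (res {n} (f ⟨$⟩ b) ≡ i × f ⟨$⟩ a ≡ f ⟨$⟩ b + 1ℤ)
      swapped (eq , eqa) with q , eq′ ← res-decompose {n} (f ⟨$⟩ b) =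
        ℤ.<-asym a<b (subst₂ _<_ (sym b≡) (sym a≡) (ℤ.+-monoˡ-< (q * + n) x<y))
        where
        fb : f ⟨$⟩ b ≡ ⟦ i ⟧ + q * + n
        fb = trans eq′ (cong (λ r → ⟦ r ⟧ + q * + n) eq)
        b≡ : b ≡ x + q * + n
        b≡ = to-injective (perm f)
          (trans fb (trans (cong (_+ q * + n) (sym fx)) (sym (periodic-* f q x))))
        lemma : ∀ u v → (u + v) + 1ℤ ≡ (u + 1ℤ) + v
        lemma = solve-∀
        a≡ : a ≡ y + q * + n
        a≡ = to-injective (perm f) (trans eqa (trans (cong (_+ 1ℤ) fb)
          (trans (lemma ⟦ i ⟧ (q * + n))
            (trans (cong (_+ q * + n) (sym fy)) (sym (periodic-* f q y))))))

  res-s : ∀ i c → res (s i ⟨$⟩ c) ≡ transpose (next i) i (res c)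
  res-s i c = ≡transpose
    (λ eq → trans (cong res (s-next i {c} eq))
      (trans (res-+ {a = c} {⟦ i ⟧ + 1ℤ} (- 1ℤ) eq)
             (trans (cong (res {n}) (lemma ⟦ i ⟧)) (res-⟦⟧ i))))
    (λ eq → trans (cong res (s-here i {c} eq))
      (res-+ {a = c} {⟦ i ⟧} 1ℤ (trans eq (sym (res-⟦⟧ i)))))
    (λ ≢n ≢i → cong res (s-other i {c} ≢i ≢n))
    where
    lemma : ∀ x → (x + 1ℤ) - 1ℤ ≡ x
    lemma = solve-∀

  lookup-∙ : ∀ i I c → lookup (i ∙ I) (res c) ≡ lookup I (res (s i ⟨$⟩ c))
  lookup-∙ i I c = trans (lookup∘tabulate _ (res c)) (cong (lookup I) (sym (res-s i c)))

  s·t·s : ∀ i I → s i · t I · s i ≈ t (i ∙ I)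
  s·t·s i I a with res (s i ⟨$⟩ a) ∈? I
  ... | yes sa∈I = trans (periodic (s i) (s i ⟨$⟩ a)) (trans (cong (_+ + n) (s-involutive i a))
          (sym (translate-∈ (i ∙ I) (+ n) {a}
            (lookup⇒[]= (res a) (i ∙ I) (trans (lookup-∙ i I a) ([]=⇒lookup sa∈I))))))
  ... | no sa∉I  = trans (s-involutive i a) (sym (translate-∉ (i ∙ I) (+ n) {a}
          (λ a∈ → sa∉I (lookup⇒[]= (res (s i ⟨$⟩ a)) I
            (trans (sym (lookup-∙ i I a)) ([]=⇒lookup a∈))))))

  ∙-fixed : ∀ i I → lookup I i ≡ lookup I (next i) → i ∙ I ≡ I
  ∙-fixed i I same = trans (tabulate-cong fixed) (tabulate∘lookup I)
    where
    fixed : ∀ j → lookup I (transpose (next i) i j) ≡ lookup I j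
    fixed j with j ≟ next i
    ... | yes refl = same
    ... | no _ with j ≟ i
    ...   | yes refl = sym same
    ...   | no _     = refl

  s·t≈t·s : ∀ i I → i ∙ I ≡ I → s i · t I ≈ t I · s i
  s·t≈t·s i I fixed a = begin
    t I ⟨$⟩ (s i ⟨$⟩ a)                         ≡⟨ s-involutive i _ ⟨
    s i ⟨$⟩ (s i ⟨$⟩ (t I ⟨$⟩ (s i ⟨$⟩ a)))      ≡⟨ cong (s i ⟨$⟩_) (s·t·s i I a) ⟩
    s i ⟨$⟩ (t (i ∙ I) ⟨$⟩ a)                   ≡⟨ cong (λ J → s i ⟨$⟩ (t J ⟨$⟩ a)) fixed ⟩
    s i ⟨$⟩ (t I ⟨$⟩ a)                         ∎
    where open ≡-Reasoning

  module _ {i : Fin n} {I : Subset n} where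

    t-∈ : i ∈ I → t I ⟨$⟩ ⟦ i ⟧ ≡ ⟦ i ⟧ + + n
    t-∈ p = translate-∈ I (+ n) {⟦ i ⟧} (subst (_∈ I) (sym (res-⟦⟧ i)) p)

    t-∉ : i ∉ I → t I ⟨$⟩ ⟦ i ⟧ ≡ ⟦ i ⟧
    t-∉ p = translate-∉ I (+ n) {⟦ i ⟧} (p ∘ subst (_∈ I) (res-⟦⟧ i))

    t-next∈ : next i ∈ I → t I ⟨$⟩ (⟦ i ⟧ + 1ℤ) ≡ (⟦ i ⟧ + 1ℤ) + + n
    t-next∈ = translate-∈ I (+ n) {⟦ i ⟧ + 1ℤ}

    t-next∉ : next i ∉ I → t I ⟨$⟩ (⟦ i ⟧ + 1ℤ) ≡ ⟦ i ⟧ + 1ℤ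
    t-next∉ = translate-∉ I (+ n) {⟦ i ⟧ + 1ℤ}

  t-minus-n : ∀ I {a b} → t I ⟨$⟩ a ≡ b + + n → t I ⟨$⟩ (a - + n) ≡ b
  t-minus-n I {a} {b} eq = begin
    t I ⟨$⟩ (a - + n)          ≡⟨ cong (λ z → t I ⟨$⟩ (a + z)) (ℤ.-1*i≡-i (+ n)) ⟨
    t I ⟨$⟩ (a + -1ℤ * + n)    ≡⟨ periodic-* (t I) -1ℤ a ⟩
    t I ⟨$⟩ a + -1ℤ * + n      ≡⟨ cong (_+ -1ℤ * + n) eq ⟩
    (b + + n) + -1ℤ * + n      ≡⟨ lemma b (+ n) ⟩
    b                          ∎
    where
    open ≡-Reasoning
    lemma : ∀ b m → (b + m) + -1ℤ * m ≡ b
    lemma = solve-∀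

  outside-≡ : ∀ {I : Subset n} {i j} → i ∉ I → j ∉ I → lookup I i ≡ lookup I j
  outside-≡ {I} {i} {j} i∉I j∉I with lookup I i in eqi | lookup I j in eqj
  ... | inside  | _ = ⊥-elim (i∉I (lookup⇒[]= i I eqi))
  ... | outside | inside  = ⊥-elim (j∉I (lookup⇒[]= j I eqj))
  ... | outside | outside = refl

  a-n<a+1 : ∀ a → a - + n < a + 1ℤ
  a-n<a+1 a = ℤ.≤-<-trans (ℤ.i-j≤i a (+ n)) (a<a+1 a)

  a+1-n<a : ∀ a → (a + 1ℤ) - + n < a
  a+1-n<a a = subst ((a + 1ℤ) - + n <_) (lemma a (+ n)) (ℤ.+-monoˡ-< (- + n) (+1<+n a))
    where
    lemma : ∀ a m → (a + m) - m ≡ a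
    lemma = solve-∀

  s·t<t : ∀ {i I} → i ∈ I → next i ∉ I → s i · t I <ᴮ t I
  s·t<t {i} {I} i∈ next∉ = s·f-ascent i (s i · t I) (t I)
    (λ a → cong (t I ⟨$⟩_) (sym (s-involutive i a)))
    (subst₂ _<_
      (sym (trans (cong (t I ⟨$⟩_) (s-⟦i⟧ i)) (t-next∉ next∉)))
      (sym (trans (cong (t I ⟨$⟩_) (s-⟦i⟧+1 i)) (t-∈ i∈)))
      (+1<+n ⟦ i ⟧))

  t<t·s : ∀ {i I} → i ∈ I → next i ∉ I → t I <ᴮ t I · s i
  t<t·s {i} {I} i∈ next∉ = f·s-ascent i (t I) (t I · s i) (λ _ → refl)
    (t-minus-n I {⟦ i ⟧} (t-∈ i∈)) (t-next∉ next∉) (a-n<a+1 ⟦ i ⟧)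

  t·s<t : ∀ {i I} → i ∉ I → next i ∈ I → t I · s i <ᴮ t I
  t·s<t {i} {I} i∉ next∈ = f·s-ascent i (t I · s i) (t I) {(⟦ i ⟧ + 1ℤ) - + n} {⟦ i ⟧}
    (λ a → sym (s-involutive i (t I ⟨$⟩ a)))
    (trans (cong (s i ⟨$⟩_) (t-minus-n I {⟦ i ⟧ + 1ℤ} (t-next∈ next∈))) (s-⟦i⟧+1 i))
    (trans (cong (s i ⟨$⟩_) (t-∉ i∉)) (s-⟦i⟧ i))
    (a+1-n<a ⟦ i ⟧)

  t<s·t : ∀ {i I} → t I ⟨$⟩ ⟦ i ⟧ < t I ⟨$⟩ (⟦ i ⟧ + 1ℤ) → t I <ᴮ s i · t I
  t<s·t {i} {I} = s·f-ascent i (t I) (s i · t I) (λ _ → refl)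

lemma6p5 : (n k : ℕ) .{{_ : NonTrivial n}} → k ≤ n →
    (I : Subset n) → ∣ I ∣ ≡ k → (i : Fin n) →
    (s i · t I · s i ≈ t (i ∙ I)) ×
    (i ∈ I × next i ∉ I → (s i · t I <ᴮ t I) × (t I <ᴮ t I · s i)) ×
    (i ∉ I × next i ∈ I → (t I · s i <ᴮ t I) × (t I <ᴮ s i · t I)) ×
    ((i ∈ I × next i ∈ I) ⊎ (i ∉ I × next i ∉ I) →
      (t I <ᴮ s i · t I) × (s i · t I ≈ t I · s i) × (i ∙ I ≡ I))
lemma6p5 n k _ I _ i =
  s·t·s i I ,
  (λ (i∈ , next∉) → s·t<t i∈ next∉ , t<t·s i∈ next∉) ,
  (λ (i∉ , next∈) → t·s<t i∉ next∈ ,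
    t<s·t (subst₂ _<_ (sym (t-∉ i∉)) (sym (t-next∈ next∈))
      (ℤ.<-≤-trans (a<a+1 ⟦ i ⟧) (ℤ.i≤i+j (⟦ i ⟧ + 1ℤ) (+ n))))) ,
  λ { (inj₁ (i∈ , next∈)) →
        let fixed = ∙-fixed i I (trans ([]=⇒lookup i∈) (sym ([]=⇒lookup next∈))) in
        t<s·t (subst₂ _<_ (sym (t-∈ i∈)) (sym (t-next∈ next∈))
          (ℤ.+-monoˡ-< (+ n) (a<a+1 ⟦ i ⟧))) ,
        s·t≈t·s i I fixed , fixed
    ; (inj₂ (i∉ , next∉)) →
        let fixed = ∙-fixed i I (outside-≡ {I = I} i∉ next∉) in
        t<s·t (subst₂ _<_ (sym (t-∉ i∉)) (sym (t-next∉ next∉)) (a<a+1 ⟦ i ⟧)) ,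
        s·t≈t·s i I fixed , fixed }
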